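{- Let $G$ be a graph of order $n$ with $\delta(G)\geq\frac56n$ whose edges have been coloured with three colours. Then $G$ has a monochromatic component of order at least $\frac n2$.
   Context: $\delta(G)$ denotes the minimum degree of $G$. For an edge-colouring of $G$, a monochromatic component of a given colour is a connected component of the graph formed by the edges of that colour (on the vertices incident with such edges); its order is its number of vertices. -}

module Defs where

open import Data.Nat using (ℕ; zero; suc; _+_; _*_; _≤_)
open import Data.Fin using (Fin)
open import Data.Bool using (Bool; true; false)
open import Data.List using (List; length; filter)
open import Data.List.Membership.Propositional using (_∈_)
open import Data.List.Relation.Unary.Unique.Propositional using (Unique)
open import Data.Product using (Σ; ∃; _×_; _,_)
open import Relation.Binary.PropositionalEquality using (_≡_; _≢_)
open import Data.Vec.Functional using (Vector)
open import Data.List using (allFin)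
open import Relation.Nullary.Decidable using (does)
open import Data.Bool using (_≟_)

record Graph (n : ℕ) : Set where
  field
    adj   : Fin n → Fin n → Bool
    sym   : ∀ u v → adj u v ≡ adj v u
    irrfl : ∀ v → adj v v ≡ false
open Graph public

Adj : ∀ {n} → Graph n → Fin n → Fin n → Set
Adj G u v = adj G u v ≡ true

degree : ∀ {n} → Graph n → Fin n → ℕ
degree {n} G v = length (filter (λ u → adj G v u ≟ true) (allFin n))

record EdgeColouring {n : ℕ} (G : Graph n) (k : ℕ) : Set where
  field
    colour    : (u v : Fin n) → Adj G u v → Fin k
    colourSym : ∀ u v (e : Adj G u v) (e' : Adj G v u) → colour u v e ≡ colour v u e'
open EdgeColouring public

ColEdge : ∀ {n k} {G : Graph n} → EdgeColouring G k → Fin k → Fin n → Fin n → Set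
ColEdge {G = G} χ c u v = Σ (Adj G u v) λ e → colour χ u v e ≡ c

data Walk {n k} {G : Graph n} (χ : EdgeColouring G k) (c : Fin k) : Fin n → Fin n → Set where
  here : ∀ {u} → Walk χ c u u
  step : ∀ {u v w} → ColEdge χ c u v → Walk χ c v w → Walk χ c u w

InColour : ∀ {n k} {G : Graph n} → EdgeColouring G k → Fin k → Fin n → Set
InColour χ c v = ∃ λ u → ColEdge χ c v u

InOneComponent : ∀ {n k} {G : Graph n} → EdgeColouring G k → Fin k → List (Fin n) → Set
InOneComponent χ c S =
  Unique S
  × (∀ {v} → v ∈ S → InColour χ c v)
  × (∀ {u v} → u ∈ S → v ∈ S → Walk χ c u v)

{-# OPTIONS --safe #-}
module Submission where

-- Suppose every monochromatic component has fewer than n/2 vertices, and give each vertex its three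
-- component labels f, g, h.  Adjacent vertices share a label, so the set D(x) of vertices sharing no
-- label with x has fewer than n/6 elements.  Weigh D(x) by 1 and a component by 3: sets of total
-- weight at most 6m cannot cover every vertex m times.  Successive coverings of this kind show that
--   * no component contains three vertices that pairwise differ in both other labels;
--   * a cell (the vertices with three given labels) has fewer than n/6 vertices;
--   * two vertices sharing exactly one label have no common vertex disjoint from both;
--   * no three vertices are pairwise disjoint.
-- With these facts and the remark that two components never cover all vertices, disjoint pairs are
-- excluded combinatorially, and a family of pairwise meeting label triples is covered by two components.

open import Defs
open import Data.Nat using (ℕ; zero; suc; _+_; _*_; _≤_; _<_; _≤?_; _<?_; z≤n; s≤s)
open import Data.Nat.Properties
  using (≤-refl; ≤-reflexive; ≤-trans; ≤-<-trans; <-≤-trans; <-irrefl; ≮⇒≥; ≰⇒>; <⇒≤; m≤m+n; m≤n⇒m≤1+n;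
         +-mono-≤; +-mono-<-≤; +-monoˡ-≤; +-monoʳ-≤; +-cancelˡ-≤; +-cancelˡ-<; +-suc; +-commutativeSemigroup;
         *-monoʳ-≤; *-monoʳ-<; *-monoˡ-≤; *-distribˡ-+; *-distribʳ-+; *-assoc; *-comm; module ≤-Reasoning)
open import Algebra.Properties.CommutativeSemigroup +-commutativeSemigroup using (x∙yz≈y∙xz)
open import Data.Fin as Fin using (Fin)
open import Data.Fin.Patterns using (0F; 1F; 2F)
open import Data.Fin.Properties using (_≟_; any?)
import Data.Bool as Bool
open import Data.Bool using (true; if_then_else_)
open import Data.List using (List; []; _∷_; length; filter; allFin; map; cartesianProduct)
open import Data.Nat.ListAction using (sum)
open import Data.List.Properties using (length-tabulate; filter-notAll)
open import Data.List.Membership.Propositional using (_∈_; lose)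
open import Data.List.Membership.Propositional.Properties
  using (∈-allFin; ∈-cartesianProduct⁺; ∈-filter⁻)
open import Data.List.Relation.Unary.All as All using (All; []; _∷_)
open import Data.List.Relation.Unary.AllPairs using ([]; _∷_)
import Data.List.Relation.Unary.Any as Any
open import Data.List.Relation.Unary.Unique.Propositional using (Unique)
open import Data.List.Relation.Unary.Unique.Propositional.Properties using (filter⁺; allFin⁺)
open import Axiom.UniquenessOfIdentityProofs using (module Decidable⇒UIP)
open import Data.Product using (∃; _×_; _,_; proj₁; proj₂)
open import Data.Sum using (_⊎_; inj₁; inj₂; [_,_]′)
open import Data.Empty using (⊥; ⊥-elim)
open import Function using (_∘_; id)
open import Level using (0ℓ)
open import Relation.Binary using (Rel; IsEquivalence)
import Relation.Binary as B
open import Relation.Binary.PropositionalEquality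
  using (_≡_; _≢_; refl; trans; cong; subst) renaming (sym to ≡-sym)
open import Relation.Nullary using (¬_; Dec; yes; no; contradiction; does)
open import Relation.Nullary.Decidable using (True; toWitness; ¬?; _×-dec_; _⊎-dec_)
open import Relation.Unary using (Pred; Decidable)

-- Counting vertices that satisfy decidable predicates.

private variable
  n m : ℕ
  P Q : Pred (Fin n) 0ℓ

size : {P : Pred (Fin n) 0ℓ} → Decidable P → ℕ
size {n} P? = length (filter P? (allFin n))

length-filter-∷ : (P? : Decidable P) (x : Fin n) (xs : List (Fin n)) →
  length (filter P? xs) ≤ length (filter P? (x ∷ xs))
length-filter-∷ P? x xs with P? x
... | yes _ = m≤n⇒m≤1+n ≤-refl
... | no  _ = ≤-refl

length-filter-mono : (P? : Decidable P) (Q? : Decidable Q) → (∀ {v} → P v → Q v) →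
  ∀ xs → length (filter P? xs) ≤ length (filter Q? xs)
length-filter-mono P? Q? P⊆Q [] = z≤n
length-filter-mono P? Q? P⊆Q (x ∷ xs) with P? x | Q? x
... | yes _ | yes _ = s≤s (length-filter-mono P? Q? P⊆Q xs)
... | yes p | no ¬q = contradiction (P⊆Q p) ¬q
... | no  _ | yes _ = m≤n⇒m≤1+n (length-filter-mono P? Q? P⊆Q xs)
... | no  _ | no  _ = length-filter-mono P? Q? P⊆Q xs

length-filter-exclusive : (P? : Decidable P) (Q? : Decidable Q) → (∀ {v} → P v → Q v → ⊥) →
  ∀ xs → length (filter P? xs) + length (filter Q? xs) ≤
         length (filter (λ v → P? v ⊎-dec Q? v) xs)
length-filter-exclusive P? Q? P∩Q=∅ [] = z≤n
length-filter-exclusive P? Q? P∩Q=∅ (x ∷ xs) with P? x | Q? x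
... | yes p | yes q = ⊥-elim (P∩Q=∅ p q)
... | yes _ | no  _ = s≤s (length-filter-exclusive P? Q? P∩Q=∅ xs)
... | no  _ | yes _ rewrite +-suc (length (filter P? xs)) (length (filter Q? xs)) =
  s≤s (length-filter-exclusive P? Q? P∩Q=∅ xs)
... | no  _ | no  _ = length-filter-exclusive P? Q? P∩Q=∅ xs

length-filter-∁ : (P? : Decidable P) → ∀ xs →
  length (filter P? xs) + length (filter (λ v → ¬? (P? v)) xs) ≡ length xs
length-filter-∁ P? [] = refl
length-filter-∁ P? (x ∷ xs) with P? x
... | yes _ = cong suc (length-filter-∁ P? xs)
... | no  _ = trans (+-suc _ _) (cong suc (length-filter-∁ P? xs))

size-mono : (P? : Decidable P) (Q? : Decidable Q) → (∀ {v} → P v → Q v) → size P? ≤ size Q?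
size-mono P? Q? P⊆Q = length-filter-mono P? Q? P⊆Q (allFin _)

length-allFin : ∀ n → length (allFin n) ≡ n
length-allFin n = length-tabulate {n = n} id

-- The unit of weight is a sixth of `n`, multiplied out to avoid division: weight 3 means fewer than
-- half of the vertices.
Light : ℕ → {P : Pred (Fin n) 0ℓ} → Decidable P → Set
Light {n} w P? = 6 * size P? < w * n

light? : (w : ℕ) (P? : Decidable {A = Fin n} P) → Dec (Light w P?)
light? w P? = _ <? _

Light-mono : (w : ℕ) (P? : Decidable P) (Q? : Decidable Q) → (∀ {v} → P v → Q v) → Light w Q? → Light w P?
Light-mono w P? Q? P⊆Q = ≤-<-trans (*-monoʳ-≤ 6 (size-mono P? Q? P⊆Q))

size-∁-bound : (P? : Decidable {A = Fin n} P) → 1 * n ≤ 6 * size P? → 6 * size (λ v → ¬? (P? v)) ≤ 5 * n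
size-∁-bound {n} P? l = +-cancelˡ-≤ (1 * n) _ _ (begin
  1 * n + 6 * size ∁P?           ≤⟨ +-monoˡ-≤ (6 * size ∁P?) l ⟩
  6 * size P? + 6 * size ∁P?     ≡⟨ *-distribˡ-+ 6 (size P?) (size ∁P?) ⟨
  6 * (size P? + size ∁P?)       ≡⟨ cong (6 *_) (length-filter-∁ P? (allFin n)) ⟩
  6 * length (allFin n)          ≡⟨ cong (6 *_) (length-allFin n) ⟩
  6 * n                          ≡⟨ *-distribʳ-+ n 1 5 ⟩
  1 * n + 5 * n                  ∎)
  where
  open ≤-Reasoning
  ∁P? = λ v → ¬? (P? v)

-- Weighted coverings.

record Piece (n : ℕ) : Set₁ where
  constructor piece
  field
    {member} : Pred (Fin n) 0ℓ
    member?  : Decidable member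
    weight   : ℕ
    bound    : 6 * size member? ≤ weight * n
open Piece

light : (w : ℕ) (P? : Decidable {A = Fin n} P) → Light w P? → Piece n
light w P? l = piece P? w (<⇒≤ l)

weights : List (Piece n) → ℕ
weights Ss = sum (map weight Ss)

-- Multiplicity counts positions in the list, so a piece listed twice counts twice. As `done`
-- accepts any remaining list, `m` is only a lower bound.
data Covered (v : Fin n) : ℕ → List (Piece n) → Set₁ where
  done : ∀ {Ss} → Covered v 0 Ss
  hit  : ∀ {S Ss} → member S v → Covered v m Ss → Covered v (suc m) (S ∷ Ss)
  skip : ∀ {S Ss} → Covered v m Ss → Covered v m (S ∷ Ss)

lengths : List (Piece n) → List (Fin n) → ℕ
lengths Ss xs = sum (map (λ S → length (filter (member? S) xs)) Ss)

-- Adding `x` raises the count of a piece at each `hit` and lowers no count. Summed over the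
-- vertices, this is the double counting behind `cover`.
lengths-∷ : ∀ {x : Fin n} {Ss} xs → Covered x m Ss → m + lengths Ss xs ≤ lengths Ss (x ∷ xs)
lengths-∷ {Ss = []} xs done = z≤n
lengths-∷ {x = x} {Ss = S ∷ Ss} xs done = +-mono-≤ (length-filter-∷ (member? S) x xs) (lengths-∷ {Ss = Ss} xs done)
lengths-∷ {x = x} {Ss = S ∷ Ss} xs (skip {m = m} c) = ≤-trans
  (≤-reflexive (x∙yz≈y∙xz m (length (filter (member? S) xs)) (lengths Ss xs)))
  (+-mono-≤ (length-filter-∷ (member? S) x xs) (lengths-∷ xs c))
lengths-∷ {x = x} {Ss = S ∷ Ss} xs (hit {m = m} s c) with member? S x
... | no ¬s = contradiction s ¬s
... | yes _ = s≤s (≤-trans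
  (≤-reflexive (x∙yz≈y∙xz m (length (filter (member? S) xs)) (lengths Ss xs)))
  (+-monoʳ-≤ (length (filter (member? S) xs)) (lengths-∷ xs c)))

lengths-covered : ∀ {Ss : List (Piece n)} → (∀ v → Covered v m Ss) → ∀ xs → length xs * m ≤ lengths Ss xs
lengths-covered c [] = z≤n
lengths-covered {m = m} c (x ∷ xs) = ≤-trans (+-monoʳ-≤ m (lengths-covered c xs)) (lengths-∷ xs (c x))

lengths-bound : (Ss : List (Piece n)) → 6 * lengths Ss (allFin n) ≤ weights Ss * n
lengths-bound [] = z≤n
lengths-bound {n} (S ∷ Ss) = begin
  6 * (size (member? S) + lengths Ss (allFin n))      ≡⟨ *-distribˡ-+ 6 (size (member? S)) _ ⟩
  6 * size (member? S) + 6 * lengths Ss (allFin n)    ≤⟨ +-mono-≤ (bound S) (lengths-bound Ss) ⟩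
  weight S * n + weights Ss * n                       ≡⟨ *-distribʳ-+ n (weight S) _ ⟨
  weights (S ∷ Ss) * n                                ∎
  where open ≤-Reasoning

-- Double counting: covering every vertex `m` times needs total size at least `n * m`. One strict
-- bound suffices for the contradiction, so the other pieces may have non-strict bounds, as
-- complements of heavy cells do. The weight check is settled by computation on numerals.
cover : ∀ m w (P? : Decidable {A = Fin n} P) (l : Light w P?) (Ss : List (Piece n)) →
  {True (w + weights Ss ≤? 6 * m)} → ¬ (∀ v → Covered v m (light w P? l ∷ Ss))
cover {n} m w P? l Ss {total} covered = <-irrefl refl (begin-strict
  6 * (n * m)                                         ≡⟨ cong (λ k → 6 * (k * m)) (length-allFin n) ⟨
  6 * (length (allFin n) * m)                         ≤⟨ *-monoʳ-≤ 6 (lengths-covered covered (allFin n)) ⟩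
  6 * (size P? + lengths Ss (allFin n))               ≡⟨ *-distribˡ-+ 6 (size P?) _ ⟩
  6 * size P? + 6 * lengths Ss (allFin n)             <⟨ +-mono-<-≤ l (lengths-bound Ss) ⟩
  w * n + weights Ss * n                              ≡⟨ *-distribʳ-+ n w _ ⟨
  (w + weights Ss) * n                                ≤⟨ *-monoˡ-≤ n (toWitness total) ⟩
  6 * m * n                                           ≡⟨ *-assoc 6 m n ⟩
  6 * (m * n)                                         ≡⟨ cong (6 *_) (*-comm m n) ⟩
  6 * (n * m)                                         ∎)
  where open ≤-Reasoning

clash : ∀ {a} {A : Set a} {x y z : Fin n} → y ≢ z → x ≡ y → x ≡ z → A
clash y≢z x≡y x≡z = contradiction (trans (≡-sym x≡y) x≡z) y≢z

≢-sym : {x y : Fin n} → x ≢ y → y ≢ x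
≢-sym x≢y = x≢y ∘ ≡-sym

-- Label triples and balanced labellings.

Labelling : ℕ → Set
Labelling n = Fin n → Fin n

private variable
  f g h : Labelling n
  o x y z : Fin n

Disjoint : (f g h : Labelling n) → Fin n → Pred (Fin n) 0ℓ
Disjoint f g h x v = f v ≢ f x × g v ≢ g x × h v ≢ h x

disjoint? : (f g h : Labelling n) (x : Fin n) → Decidable (Disjoint f g h x)
disjoint? f g h x v = ¬? (f v ≟ f x) ×-dec ¬? (g v ≟ g x) ×-dec ¬? (h v ≟ h x)

Disjoint-sym : Disjoint f g h x y → Disjoint f g h y x
Disjoint-sym (a , b , c) = ≢-sym a , ≢-sym b , ≢-sym c

Meets : (f g h : Labelling n) → Fin n → Pred (Fin n) 0ℓ
Meets f g h x v = f v ≡ f x ⊎ g v ≡ g x ⊎ h v ≡ h x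

pattern byf e = inj₁ e
pattern byg e = inj₂ (inj₁ e)
pattern byh e = inj₂ (inj₂ e)

disjoint⊎meets : (f g h : Labelling n) → ∀ x v → Disjoint f g h x v ⊎ Meets f g h x v
disjoint⊎meets f g h x v with f v ≟ f x | g v ≟ g x | h v ≟ h x
... | yes p | _     | _     = inj₂ (byf p)
... | no  _ | yes q | _     = inj₂ (byg q)
... | no  _ | no  _ | yes r = inj₂ (byh r)
... | no  p | no  q | no  r = inj₁ (p , q , r)

Class : Labelling n → Fin n → Pred (Fin n) 0ℓ
Class f x v = f v ≡ f x

class? : (f : Labelling n) (x : Fin n) → Decidable (Class f x)
class? f x v = f v ≟ f x

Cell : (f g h : Labelling n) → Fin n → Fin n → Fin n → Pred (Fin n) 0ℓ
Cell f g h x y z v = f v ≡ f x × g v ≡ g y × h v ≡ h z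

cell? : (f g h : Labelling n) (x y z : Fin n) → Decidable (Cell f g h x y z)
cell? f g h x y z v = (f v ≟ f x) ×-dec (g v ≟ g y) ×-dec (h v ≟ h z)

-- All that is retained of a counterexample: the first field will come from the minimum degree, the
-- others from the small components. It is symmetric in the three labellings, so each argument is
-- given for one order and transported by the swaps.
record Balanced (f g h : Labelling n) : Set where
  field
    disjoint-light : ∀ x → Light 1 (disjoint? f g h x)
    class₁-light   : ∀ x → Light 3 (class? f x)
    class₂-light   : ∀ x → Light 3 (class? g x)
    class₃-light   : ∀ x → Light 3 (class? h x)
open Balanced

swap₁₂ : Balanced f g h → Balanced g f h
swap₁₂ {f = f} {g} {h} B = record
  { disjoint-light = λ x → Light-mono 1 (disjoint? g f h x) (disjoint? f g h x)
      (λ (a , b , c) → b , a , c) (disjoint-light B x)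
  ; class₁-light = class₂-light B
  ; class₂-light = class₁-light B
  ; class₃-light = class₃-light B
  }

swap₂₃ : Balanced f g h → Balanced f h g
swap₂₃ {f = f} {g} {h} B = record
  { disjoint-light = λ x → Light-mono 1 (disjoint? f h g x) (disjoint? f g h x)
      (λ (a , b , c) → a , c , b) (disjoint-light B x)
  ; class₁-light = class₁-light B
  ; class₂-light = class₃-light B
  ; class₃-light = class₂-light B
  }

swap₁₃ : Balanced f g h → Balanced h g f
swap₁₃ = swap₁₂ ∘ swap₂₃ ∘ swap₁₂

module _ {f g h : Labelling n} (B : Balanced f g h) where
  disjointPiece : Fin n → Piece n
  disjointPiece x = light 1 (disjoint? f g h x) (disjoint-light B x)

  classPiece₁ classPiece₂ classPiece₃ : Fin n → Piece n
  classPiece₁ x = light 3 (class? f x) (class₁-light B x)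
  classPiece₂ x = light 3 (class? g x) (class₂-light B x)
  classPiece₃ x = light 3 (class? h x) (class₃-light B x)

  -- Two classes weigh 3 + 3 = 6 with strict bounds, so together they have fewer than `n` vertices.
  two-classes-omit₁₁ : ∀ x y → ∃ λ v → f v ≢ f x × f v ≢ f y
  two-classes-omit₁₁ x y with any? (λ v → ¬? (f v ≟ f x) ×-dec ¬? (f v ≟ f y))
  ... | yes p = p
  ... | no ¬p = ⊥-elim (cover 1 3 (class? f x) (class₁-light B x) (classPiece₁ y ∷ []) covered)
    where
    covered : ∀ v → Covered v 1 _
    covered v with f v ≟ f x | f v ≟ f y
    ... | yes a | _     = hit a done
    ... | no  _ | yes b = skip (hit b done)
    ... | no  a | no  b = contradiction (v , a , b) ¬p

  two-classes-omit₁₂ : ∀ x y → ∃ λ v → f v ≢ f x × g v ≢ g y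
  two-classes-omit₁₂ x y with any? (λ v → ¬? (f v ≟ f x) ×-dec ¬? (g v ≟ g y))
  ... | yes p = p
  ... | no ¬p = ⊥-elim (cover 1 3 (class? f x) (class₁-light B x) (classPiece₂ y ∷ []) covered)
    where
    covered : ∀ v → Covered v 1 _
    covered v with f v ≟ f x | g v ≟ g y
    ... | yes a | _     = hit a done
    ... | no  _ | yes b = skip (hit b done)
    ... | no  a | no  b = contradiction (v , a , b) ¬p

Distinct : Labelling n → (x y z : Fin n) → Set
Distinct f x y z = f x ≢ f y × f x ≢ f z × f y ≢ f z

-- The class and the three disjoint sets weigh 3 + 1 + 1 + 1. A vertex outside all four agrees with
-- each of `x`, `y`, `z` in `g` or `h`, hence with two of them in the same labelling, although these
-- two differ there.
no-transversal-in-class : Balanced f g h → f y ≡ f x → f z ≡ f x →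
  Distinct g x y z → Distinct h x y z → ⊥
no-transversal-in-class {f = f} {g} {h} {y} {x} {z} B fy fz (gxy , gxz , gyz) (hxy , hxz , hyz) =
  cover 1 1 (disjoint? f g h x) (disjoint-light B x)
    (disjointPiece B y ∷ disjointPiece B z ∷ classPiece₁ B x ∷ []) covered
  where
  covered : ∀ v → Covered v 1 _
  covered v with disjoint⊎meets f g h x v | disjoint⊎meets f g h y v | disjoint⊎meets f g h z v
  ... | inj₁ d | _ | _ = hit d done
  ... | _ | inj₁ d | _ = skip (hit d done)
  ... | _ | _ | inj₁ d = skip (skip (hit d done))
  ... | inj₂ (byf p) | _ | _ = skip (skip (skip (hit p done)))
  ... | _ | inj₂ (byf p) | _ = skip (skip (skip (hit (trans p fy) done)))
  ... | _ | _ | inj₂ (byf p) = skip (skip (skip (hit (trans p fz) done)))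
  ... | inj₂ (byg p) | inj₂ (byg q) | _ = clash gxy p q
  ... | inj₂ (byh p) | inj₂ (byh q) | _ = clash hxy p q
  ... | inj₂ (byg p) | _ | inj₂ (byg q) = clash gxz p q
  ... | inj₂ (byh p) | _ | inj₂ (byh q) = clash hxz p q
  ... | _ | inj₂ (byg p) | inj₂ (byg q) = clash gyz p q
  ... | _ | inj₂ (byh p) | inj₂ (byh q) = clash hyz p q

-- Every cell is light.

-- Heaviness of the vertices agreeing with o only in f, in the only form used:
-- no vertex is disjoint from all of them.
HeavyOnly : (f g h : Labelling n) → Fin n → Set
HeavyOnly f g h o = ∀ w → ¬ (∀ {x} → f x ≡ f o → g x ≢ g o → h x ≢ h o → Disjoint f g h w x)

Only : (f g h : Labelling n) → Fin n → Pred (Fin n) 0ℓ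
Only f g h o v = f v ≡ f o × g v ≢ g o × h v ≢ h o

only? : (f g h : Labelling n) (o : Fin n) → Decidable (Only f g h o)
only? f g h o v = (f v ≟ f o) ×-dec ¬? (g v ≟ g o) ×-dec ¬? (h v ≟ h o)

-- A set all of whose members are disjoint from one vertex `w` lies in a light set, so it is light
-- itself.
light⊎heavy : Balanced f g h → ∀ o → Light 1 (only? f g h o) ⊎ HeavyOnly f g h o
light⊎heavy {f = f} {g} {h} B o with light? 1 (only? f g h o)
... | yes l = inj₁ l
... | no ¬l = inj₂ λ w sub → ¬l
  (Light-mono 1 (only? f g h o) (disjoint? f g h w) (λ (a , b , c) → sub a b c) (disjoint-light B w))

heavy-inhabited : HeavyOnly f g h o → ∃ (Only f g h o)
heavy-inhabited {f = f} {g} {h} {o} X with any? (only? f g h o)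
... | yes p = p
... | no ¬p = ⊥-elim (X o λ a b c → contradiction (_ , a , b , c) ¬p)

heavy-swap₂₃ : HeavyOnly f g h o → HeavyOnly f h g o
heavy-swap₂₃ X w sub = X w λ a b c → let (d , e , k) = sub a c b in d , k , e

-- The cell has at least n/6 vertices; stated for the complement so that it can be used in a covering.
HeavyCell : (f g h : Labelling n) → Fin n → Set
HeavyCell {n} f g h o = 6 * size (λ v → ¬? (cell? f g h o o o v)) ≤ 5 * n

heavyCell-swap₁₂ : HeavyCell f g h o → HeavyCell g f h o
heavyCell-swap₁₂ {f = f} {g} {h} {o} = ≤-trans (*-monoʳ-≤ 6 (size-mono
  (λ v → ¬? (cell? g f h o o o v)) (λ v → ¬? (cell? f g h o o o v))
  (λ ¬c (a , b , c) → ¬c (b , a , c))))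

heavyCell-swap₂₃ : HeavyCell f g h o → HeavyCell f h g o
heavyCell-swap₂₃ {f = f} {g} {h} {o} = ≤-trans (*-monoʳ-≤ 6 (size-mono
  (λ v → ¬? (cell? f h g o o o v)) (λ v → ¬? (cell? f g h o o o v))
  (λ ¬c (a , b , c) → ¬c (a , c , b))))

record HeavyStar (f g h : Labelling n) (o : Fin n) : Set where
  field
    balanced : Balanced f g h
    heavy    : HeavyCell f g h o
    star     : ∀ v → Meets f g h o v
open HeavyStar

star-swap₁₂ : HeavyStar f g h o → HeavyStar g f h o
star-swap₁₂ {g = g} {o = o} H = record
  { balanced = swap₁₂ (balanced H) ; heavy = heavyCell-swap₁₂ {g = g} (heavy H)
  ; star = λ v → swap (star H v) }
  where
  swap : ∀ {A B C : Set} → A ⊎ B ⊎ C → B ⊎ A ⊎ C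
  swap (byf a) = byg a
  swap (byg a) = byf a
  swap (byh a) = byh a

star-swap₂₃ : HeavyStar f g h o → HeavyStar f h g o
star-swap₂₃ {g = g} {o = o} H = record
  { balanced = swap₂₃ (balanced H) ; heavy = heavyCell-swap₂₃ {g = g} (heavy H)
  ; star = λ v → swap (star H v) }
  where
  swap : ∀ {A B C : Set} → A ⊎ B ⊎ C → A ⊎ C ⊎ B
  swap (byf a) = byf a
  swap (byg a) = byh a
  swap (byh a) = byg a

star-swap₁₃ : HeavyStar f g h o → HeavyStar h g f o
star-swap₁₃ = star-swap₁₂ ∘ star-swap₂₃ ∘ star-swap₁₂

-- n + 2|cell| + (pairwise overlaps) ≤ |f| + |g| + |h|, and n ≤ |f| + |P| + |Q| + |overlap of g and h|;
-- the sum of the two, with |cell| replaced by its complement, is the fourfold covering.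
no-light-pair : HeavyStar f g h o →
  {P? : Decidable P} {Q? : Decidable Q} → Light 1 P? → Light 1 Q? →
  (∀ v → f v ≢ f o → g v ≢ g o ⊎ h v ≢ h o → P v ⊎ Q v) → ⊥
no-light-pair {f = f} {g} {h} {o} H {P?} {Q?} p q out =
  cover 4 3 (class? f o) (class₁-light B o)
    (classPiece₁ B o ∷ classPiece₂ B o ∷ classPiece₃ B o ∷
     light 1 P? p ∷ light 1 Q? q ∷ co ∷ co ∷ []) covered
  where
  B = balanced H
  co = piece (λ v → ¬? (cell? f g h o o o v)) 5 (heavy H)
  covered : ∀ v → Covered v 4 _
  covered v with f v ≟ f o | g v ≟ g o | h v ≟ h o
  ... | yes a | yes b | yes c = hit a (hit a (hit b (hit c done)))
  ... | yes a | yes b | no ¬c =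
    hit a (hit a (hit b (skip (skip (skip (hit (λ k → ¬c (proj₂ (proj₂ k))) done))))))
  ... | yes a | no ¬b | _ =
    hit a (hit a (skip (skip (skip (skip (hit k (hit k done)))))))
    where k = λ k → ¬b (proj₁ (proj₂ k))
  ... | no ¬a | yes b | yes c =
    skip (skip (hit b (hit c (skip (skip (hit k (hit k done)))))))
    where k = λ k → ¬a (proj₁ k)
  ... | no ¬a | no ¬b | no ¬c = contradiction (star H v) [ ¬a , [ ¬b , ¬c ]′ ]′
  covered v | no ¬a | yes b | no ¬c with out v ¬a (inj₂ ¬c)
  ... | inj₁ s = skip (skip (hit b (skip (hit s (skip (hit (λ k → ¬a (proj₁ k)) (hit (λ k → ¬a (proj₁ k)) done)))))))
  ... | inj₂ s = skip (skip (hit b (skip (skip (hit s (hit (λ k → ¬a (proj₁ k)) (hit (λ k → ¬a (proj₁ k)) done)))))))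
  covered v | no ¬a | no ¬b | yes c with out v ¬a (inj₁ ¬b)
  ... | inj₁ s = skip (skip (skip (hit c (hit s (skip (hit (λ k → ¬a (proj₁ k)) (hit (λ k → ¬a (proj₁ k)) done)))))))
  ... | inj₂ s = skip (skip (skip (hit c (skip (hit s (hit (λ k → ¬a (proj₁ k)) (hit (λ k → ¬a (proj₁ k)) done)))))))

-- The sets disjoint from `x` and from `y` serve as the light pair. If `v` lies outside the
-- `f`-class of `o` and agrees with `o` in `g` only, it is disjoint from `x` unless `h v ≡ h x`, and
-- from `y` unless `h v ≡ h y`; both cannot hold. The other case exchanges `g` and `h`.
only-meet : HeavyStar f g h o → Only f g h o x → Only f g h o y → g x ≢ g y → h x ≢ h y → ⊥
only-meet {f = f} {g} {h} {o} {x} {y} H (fx , gx , hx) (fy , gy , hy) gxy hxy =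
  no-light-pair H (disjoint-light B x) (disjoint-light B y) out
  where
  B = balanced H
  out : ∀ v → f v ≢ f o → g v ≢ g o ⊎ h v ≢ h o → Disjoint f g h x v ⊎ Disjoint f g h y v
  out v ¬a e with star H v | e
  ... | byf a | _ = contradiction a ¬a
  ... | byg b | inj₁ ¬b = contradiction b ¬b
  ... | byh c | inj₂ ¬c = contradiction c ¬c
  ... | byg b | inj₂ _ with h v ≟ h x
  ...   | no ¬e = inj₁ ((λ a → ¬a (trans a fx)) , (λ b′ → gx (trans (≡-sym b′) b)) , ¬e)
  ...   | yes e = inj₂ ((λ a → ¬a (trans a fy)) , (λ b′ → gy (trans (≡-sym b′) b)) , clash hxy e)
  out v ¬a e | byh c | inj₁ _ with g v ≟ g x
  ...   | no ¬e = inj₁ ((λ a → ¬a (trans a fx)) , ¬e , (λ c′ → hx (trans (≡-sym c′) c)))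
  ...   | yes e = inj₂ ((λ a → ¬a (trans a fy)) , clash gxy e , (λ c′ → hy (trans (≡-sym c′) c)))

-- By `only-meet`, any two members of `Only f g h o` agree in `g` or in `h`, which forces one of
-- these labels to be constant on the whole set. A constant `h` is excluded because two `h`-classes
-- would then cover all vertices.
only-in-class : HeavyStar f g h o → HeavyOnly f g h o → HeavyOnly h g f o →
  ∃ λ x → Only f g h o x × (∀ {v} → Only f g h o v → g v ≡ g x)
only-in-class {f = f} {g} {h} {o} H X Z with heavy-inhabited X
... | x , Xx = x , Xx , same-g
  where
  B = balanced H

  -- Such a vertex would be disjoint from every member of the heavy set `Only h g f o`.
  fg-empty : ∀ {v} → f v ≡ f o → g v ≡ g o → h v ≢ h o → ⊥
  fg-empty {v} a b c = Z v λ p q r →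
    (λ e → c (trans (≡-sym e) p)) , (λ e → q (trans e b)) , (λ e → r (trans e a))

  not-same-h : ¬ (∀ {v} → Only f g h o v → h v ≡ h x)
  not-same-h same-h = cover 1 3 (class? h o) (class₃-light B o) (classPiece₃ B x ∷ []) covered
    where
    covered : ∀ v → Covered v 1 _
    covered v with h v ≟ h o | h v ≟ h x | f v ≟ f o | g v ≟ g o
    ... | yes c | _     | _     | _     = hit c done
    ... | no  _ | yes c | _     | _     = skip (hit c done)
    ... | no ¬c | no _  | yes a | yes b = ⊥-elim (fg-empty a b ¬c)
    ... | no ¬c | no ¬e | yes a | no ¬b = contradiction (same-h (a , ¬b , ¬c)) ¬e
    ... | no ¬c | no _  | no ¬a | no ¬b = contradiction (star H v) [ ¬a , [ ¬b , ¬c ]′ ]′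
    -- If `h` is constant on `Only f g h o`, then `v` is disjoint from that whole set.
    ... | no ¬c | no ¬e | no ¬a | yes b = ⊥-elim (X v λ p q r →
      (λ e → ¬a (trans (≡-sym e) p)) , (λ e → q (trans e b)) ,
      (λ e → ¬e (trans (≡-sym e) (same-h (p , q , r)))))

  same-g : ∀ {v} → Only f g h o v → g v ≡ g x
  same-g {v} Xv with g v ≟ g x
  ... | yes e = e
  ... | no ¬e = ⊥-elim (not-same-h same-h)
    where
    hv : h v ≡ h x
    hv with h v ≟ h x
    ... | yes e = e
    ... | no ¬e′ = ⊥-elim (only-meet H Xv Xx ¬e ¬e′)
    same-h : ∀ {u} → Only f g h o u → h u ≡ h x
    same-h {u} Xu with h u ≟ h x
    ... | yes e = e
    ... | no ¬k with g u ≟ g x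
    ...   | no ¬l = ⊥-elim (only-meet H Xu Xx ¬l ¬k)
    ...   | yes l = ⊥-elim (only-meet H Xu Xv (λ e → ¬e (trans (≡-sym e) l)) (λ e → ¬k (trans e hv)))

-- Both heavy sets lie in the `g`-class of `x`; otherwise `x` would be disjoint from all of the
-- second. If `Only g f h o` is light, this gives a double covering of weight 11. If it is heavy, no
-- vertex agrees with `o` in exactly `f` and `h`, and the `g`-classes of `o` and `x` cover
-- everything.
no-heavy-pair : HeavyStar f g h o → HeavyOnly f g h o → HeavyOnly h g f o → ⊥
no-heavy-pair {f = f} {g} {h} {o} H X Z
  with only-in-class H X Z | only-in-class (star-swap₁₃ H) Z X
... | x , (fx , gx , hx) , Xg | z , _ , Zg = by-Y (light⊎heavy (swap₁₂ B) o)
  where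
  B = balanced H

  gz : g z ≡ g x
  gz with g z ≟ g x
  ... | yes e = e
  ... | no ¬e = ⊥-elim (Z x λ p q r →
    (λ e → hx (trans (≡-sym e) p)) , (λ e → ¬e (trans (≡-sym (Zg (p , q , r))) e)) , (λ e → r (trans e fx)))

  fg-empty : ∀ {v} → f v ≡ f o → g v ≡ g o → h v ≢ h o → ⊥
  fg-empty {v} a b c = Z v λ p q r →
    (λ e → c (trans (≡-sym e) p)) , (λ e → q (trans e b)) , (λ e → r (trans e a))

  gh-empty : ∀ {v} → f v ≢ f o → g v ≡ g o → h v ≡ h o → ⊥
  gh-empty {v} a b c = X v λ p q r →
    (λ e → a (trans (≡-sym e) p)) , (λ e → q (trans e b)) , (λ e → r (trans e c))

  by-Y : ¬ (Light 1 (only? g f h o) ⊎ HeavyOnly g f h o)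
  by-Y (inj₁ Y) = cover 2 3 (class? h o) (class₃-light B o)
    (classPiece₁ B o ∷ light 1 (only? g f h o) Y ∷ light 1 (only? g f h o) Y ∷ classPiece₂ B x ∷ [])
    covered
    where
    covered : ∀ v → Covered v 2 _
    covered v with f v ≟ f o | g v ≟ g o | h v ≟ h o
    ... | yes a | _     | yes c = hit c (hit a done)
    ... | yes a | yes b | no ¬c = ⊥-elim (fg-empty a b ¬c)
    ... | yes a | no ¬b | no ¬c = skip (hit a (skip (skip (hit (Xg (a , ¬b , ¬c)) done))))
    ... | no ¬a | yes b | yes c = ⊥-elim (gh-empty ¬a b c)
    ... | no ¬a | yes b | no ¬c = skip (skip (hit (b , ¬a , ¬c) (hit (b , ¬a , ¬c) done)))
    ... | no ¬a | no ¬b | yes c = hit c (skip (skip (skip (hit (trans (Zg (c , ¬b , ¬a)) gz) done))))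
    ... | no ¬a | no ¬b | no ¬c = contradiction (star H v) [ ¬a , [ ¬b , ¬c ]′ ]′
  by-Y (inj₂ Y) = cover 1 3 (class? g o) (class₂-light B o) (classPiece₂ B x ∷ []) covered
    where
    covered : ∀ v → Covered v 1 _
    covered v with f v ≟ f o | g v ≟ g o | h v ≟ h o
    ... | _     | yes b | _     = hit b done
    ... | yes a | no ¬b | no ¬c = skip (hit (Xg (a , ¬b , ¬c)) done)
    ... | no ¬a | no ¬b | yes c = skip (hit (trans (Zg (c , ¬b , ¬a)) gz) done)
    ... | no ¬a | no ¬b | no ¬c = contradiction (star H v) [ ¬a , [ ¬b , ¬c ]′ ]′
    ... | yes a | no ¬b | yes c = ⊥-elim (Y v λ p q r →
      (λ e → ¬b (trans (≡-sym e) p)) , (λ e → q (trans e a)) , (λ e → r (trans e c)))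

-- Of the three sets of vertices sharing exactly one label with `o`, two are both light or both
-- heavy. Two light ones contain what `no-light-pair` asks for outside the class of the third label.
no-heavy-star : ¬ HeavyStar f g h o
no-heavy-star {f = f} {g} {h} {o} H
  with light⊎heavy B o | light⊎heavy (swap₁₂ B) o | light⊎heavy (swap₁₃ B) o
  where B = balanced H
... | inj₁ X | inj₁ Y | _ = no-light-pair (star-swap₁₃ H) X Y out
  where
  out : ∀ v → h v ≢ h o → g v ≢ g o ⊎ f v ≢ f o → Only f g h o v ⊎ Only g f h o v
  out v c e with star H v | e
  ... | byh p | _ = contradiction p c
  ... | byf p | inj₁ q = inj₁ (p , q , c)
  ... | byf p | inj₂ q = contradiction p q
  ... | byg p | inj₁ q = contradiction p q
  ... | byg p | inj₂ q = inj₂ (p , q , c)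
... | inj₁ X | _ | inj₁ Z = no-light-pair (star-swap₁₂ H) X Z out
  where
  out : ∀ v → g v ≢ g o → f v ≢ f o ⊎ h v ≢ h o → Only f g h o v ⊎ Only h g f o v
  out v b e with star H v | e
  ... | byg p | _ = contradiction p b
  ... | byf p | inj₁ q = contradiction p q
  ... | byf p | inj₂ q = inj₁ (p , b , q)
  ... | byh p | inj₁ q = inj₂ (p , b , q)
  ... | byh p | inj₂ q = contradiction p q
... | _ | inj₁ Y | inj₁ Z = no-light-pair H Y Z out
  where
  out : ∀ v → f v ≢ f o → g v ≢ g o ⊎ h v ≢ h o → Only g f h o v ⊎ Only h g f o v
  out v a e with star H v | e
  ... | byf p | _ = contradiction p a
  ... | byg p | inj₁ q = contradiction p q
  ... | byg p | inj₂ q = inj₁ (p , a , q)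
  ... | byh p | inj₁ q = inj₂ (p , q , a)
  ... | byh p | inj₂ q = contradiction p q
... | inj₂ X | inj₂ Y | _ = no-heavy-pair (star-swap₂₃ H) (heavy-swap₂₃ X) (heavy-swap₂₃ Y)
... | inj₂ X | _ | inj₂ Z = no-heavy-pair H X Z
... | _ | inj₂ Y | inj₂ Z = no-heavy-pair (star-swap₁₂ H) Y (heavy-swap₂₃ Z)

-- A vertex disjoint from `o` is disjoint from the whole cell of `o`, which would make the cell
-- light. So a heavy cell yields a `HeavyStar`.
cell-light : Balanced f g h → ∀ o → Light 1 (cell? f g h o o o)
cell-light {f = f} {g} {h} B o with light? 1 (cell? f g h o o o)
... | yes l = l
... | no ¬l = ⊥-elim (no-heavy-star record { balanced = B ; heavy = heavyCell (≮⇒≥ ¬l) ; star = meets })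
  where
  meets : ∀ v → Meets f g h o v
  meets v with disjoint⊎meets f g h o v
  ... | inj₂ e = e
  ... | inj₁ (a , b , c) = contradiction (Light-mono 1 (cell? f g h o o o) (disjoint? f g h v)
    (λ (p , q , r) → (λ e → a (trans (≡-sym e) p)) , (λ e → b (trans (≡-sym e) q)) , (λ e → c (trans (≡-sym e) r)))
    (disjoint-light B v)) ¬l
  heavyCell : 1 * _ ≤ 6 * size (cell? f g h o o o) → HeavyCell f g h o
  heavyCell = size-∁-bound (cell? f g h o o o)

-- Pairs of vertices with a common disjoint vertex.

via : {a a′ b b′ : Fin n} → a ≡ a′ → b ≡ b′ → a′ ≢ b′ → a ≢ b
via p q a′≢b′ a≡b = a′≢b′ (trans (≡-sym p) (trans a≡b q))

-- At most one of the two cells is inhabited, so their union costs weight 1 instead of 2. If both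
-- are empty, any light set bounds the union; the set disjoint from `a` is taken.
incompatible-cells-light : Balanced f g h → ∀ {a b c a′ b′ c′} →
  (∀ {u v} → Cell f g h a b c u → Cell f g h a′ b′ c′ v → ⊥) →
  Light 1 (λ v → cell? f g h a b c v ⊎-dec cell? f g h a′ b′ c′ v)
incompatible-cells-light {f = f} {g} {h} B {a} {b} {c} {a′} {b′} {c′} incompatible
  with any? (cell? f g h a b c)
... | yes (u , p , q , r) = Light-mono 1
  (λ v → cell? f g h a b c v ⊎-dec cell? f g h a′ b′ c′ v) (cell? f g h u u u)
  (λ { (inj₁ (p′ , q′ , r′)) → trans p′ (≡-sym p) , trans q′ (≡-sym q) , trans r′ (≡-sym r)
     ; (inj₂ c′) → ⊥-elim (incompatible (p , q , r) c′) })
  (cell-light B u)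
... | no ¬u with any? (cell? f g h a′ b′ c′)
...   | yes (u , p , q , r) = Light-mono 1
  (λ v → cell? f g h a b c v ⊎-dec cell? f g h a′ b′ c′ v) (cell? f g h u u u)
  (λ { (inj₁ c) → contradiction (_ , c) ¬u
     ; (inj₂ (p′ , q′ , r′)) → trans p′ (≡-sym p) , trans q′ (≡-sym q) , trans r′ (≡-sym r) })
  (cell-light B u)
...   | no ¬v = Light-mono 1
  (λ v → cell? f g h a b c v ⊎-dec cell? f g h a′ b′ c′ v) (disjoint? f g h a)
  (λ { (inj₁ c) → contradiction (_ , c) ¬u ; (inj₂ c) → contradiction (_ , c) ¬v })
  (disjoint-light B a)

-- With the labels of x, y, z written 111, 222, 233, a vertex meeting all three lies in one of the six cells
-- 212, 221, 213, 231, 123, 132, and consecutive pairs of these cannot both be inhabited.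
no-single-agreement : Balanced f g h → Disjoint f g h x y → Disjoint f g h x z →
  f z ≡ f y → g z ≢ g y → h z ≢ h y → ⊥
no-single-agreement {f = f} {g} {h} {x} {y} {z} B (fyx , gyx , hyx) (fzx , gzx , hzx) fzy gzy hzy =
  cover 1 1 (disjoint? f g h x) (disjoint-light B x)
    (disjointPiece B y ∷ disjointPiece B z ∷
     light 1 _ U₁ ∷ light 1 _ U₂ ∷ light 1 _ U₃ ∷ []) covered
  where
  U₁ = incompatible-cells-light B {y} {x} {y} {y} {y} {x} λ (p , q , r) (p′ , q′ , r′) →
    no-transversal-in-class B (trans p (≡-sym fzy)) (trans p′ (≡-sym fzy))
      (via refl q gzx , via refl q′ gzy , via q q′ (≢-sym gyx))
      (via refl r hzy , via refl r′ hzx , via r r′ hyx)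
  U₂ = incompatible-cells-light B {y} {x} {z} {y} {z} {x} λ (p , q , r) (p′ , q′ , r′) →
    no-transversal-in-class B p p′
      (via refl q gyx , via refl q′ (≢-sym gzy) , via q q′ (≢-sym gzx))
      (via refl r (≢-sym hzy) , via refl r′ hyx , via r r′ hzx)
  U₃ = incompatible-cells-light B {x} {y} {z} {x} {z} {y} λ (p , q , r) (p′ , q′ , r′) →
    no-transversal-in-class B p p′
      (via refl q (≢-sym gyx) , via refl q′ (≢-sym gzx) , via q q′ (≢-sym gzy))
      (via refl r (≢-sym hzx) , via refl r′ (≢-sym hyx) , via r r′ hzy)

  covered : ∀ v → Covered v 1 _
  in-class-g : ∀ v → f v ≡ f y → g v ≡ g x → Covered v 1 _
  in-class-h : ∀ v → f v ≡ f y → h v ≡ h x → Covered v 1 _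

  covered v with disjoint⊎meets f g h x v | disjoint⊎meets f g h y v | disjoint⊎meets f g h z v
  ... | inj₁ d | _ | _ = hit d done
  ... | _ | inj₁ d | _ = skip (hit d done)
  ... | _ | _ | inj₁ d = skip (skip (hit d done))
  ... | inj₂ (byf p) | inj₂ (byf q) | _ = clash fyx q p
  ... | inj₂ (byf p) | _ | inj₂ (byf q) = clash fzx q p
  ... | _ | inj₂ (byg p) | inj₂ (byg q) = clash gzy q p
  ... | _ | inj₂ (byh p) | inj₂ (byh q) = clash hzy q p
  ... | inj₂ (byf p) | inj₂ (byg q) | inj₂ (byh r) = skip (skip (skip (skip (skip (hit (inj₁ (p , q , r)) done)))))
  ... | inj₂ (byf p) | inj₂ (byh q) | inj₂ (byg r) = skip (skip (skip (skip (skip (hit (inj₂ (p , r , q)) done)))))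
  ... | inj₂ (byg p) | inj₂ (byg q) | _ = clash gyx q p
  ... | inj₂ (byg p) | _ | inj₂ (byg q) = clash gzx q p
  ... | inj₂ (byg p) | inj₂ (byf q) | _ = in-class-g v q p
  ... | inj₂ (byg p) | _ | inj₂ (byf q) = in-class-g v (trans q fzy) p
  ... | inj₂ (byh p) | inj₂ (byh q) | _ = clash hyx q p
  ... | inj₂ (byh p) | _ | inj₂ (byh q) = clash hzx q p
  ... | inj₂ (byh p) | inj₂ (byf q) | _ = in-class-h v q p
  ... | inj₂ (byh p) | _ | inj₂ (byf q) = in-class-h v (trans q fzy) p

  in-class-g v p q with h v ≟ h y | h v ≟ h z
  ... | yes r | _     = skip (skip (skip (hit (inj₁ (p , q , r)) done)))
  ... | no  _ | yes r = skip (skip (skip (skip (hit (inj₁ (p , q , r)) done))))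
  ... | no  r | no  s = ⊥-elim (no-transversal-in-class B fzy p
    (≢-sym gzy , via refl q gyx , via refl q gzx) (≢-sym hzy , ≢-sym r , ≢-sym s))

  in-class-h v p q with g v ≟ g y | g v ≟ g z
  ... | yes r | _     = skip (skip (skip (hit (inj₂ (p , r , q)) done)))
  ... | no  _ | yes r = skip (skip (skip (skip (hit (inj₂ (p , r , q)) done))))
  ... | no  r | no  s = ⊥-elim (no-transversal-in-class B fzy p
    (≢-sym gzy , ≢-sym r , ≢-sym s) (≢-sym hzy , via refl q hyx , via refl q hzx))

AgreeTwice : (f g h : Labelling n) → Fin n → Pred (Fin n) 0ℓ
AgreeTwice f g h x v = (f v ≡ f x × g v ≡ g x) ⊎ (f v ≡ f x × h v ≡ h x) ⊎ (g v ≡ g x × h v ≡ h x)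

pattern fg a b = inj₁ (a , b)
pattern fh a c = inj₂ (inj₁ (a , c))
pattern gh b c = inj₂ (inj₂ (b , c))

disjoint⊎agreeTwice : Balanced f g h → Disjoint f g h x y → Disjoint f g h x z →
  Disjoint f g h y z ⊎ AgreeTwice f g h y z
disjoint⊎agreeTwice {f = f} {g} {h} {x} {y} {z} B (a , b , c) (a′ , b′ , c′)
  with f z ≟ f y | g z ≟ g y | h z ≟ h y
... | yes p | yes q | _     = inj₂ (fg p q)
... | yes p | no  _ | yes r = inj₂ (fh p r)
... | no  _ | yes q | yes r = inj₂ (gh q r)
... | no  p | no  q | no  r = inj₁ (p , q , r)
... | yes p | no  q | no  r = ⊥-elim (no-single-agreement B (a , b , c) (a′ , b′ , c′) p q r)
... | no  p | yes q | no  r = ⊥-elim (no-single-agreement (swap₁₂ B) (b , a , c) (b′ , a′ , c′) q p r)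
... | no  p | no  q | yes r = ⊥-elim (no-single-agreement (swap₁₃ B) (c , b , a) (c′ , b′ , a′) r q p)

-- Otherwise `v` shares two labels with `y` and two with `z`. Two pairs out of three labels overlap,
-- so `y` and `z` would share a label.
missed-twice : Balanced f g h → Disjoint f g h x y → Disjoint f g h x z → Disjoint f g h y z →
  ∀ {v} → Disjoint f g h x v → Disjoint f g h y v ⊎ Disjoint f g h z v
missed-twice B xy xz (a , b , c) xv with disjoint⊎agreeTwice B xy xv | disjoint⊎agreeTwice B xz xv
... | inj₁ yv | _ = inj₁ yv
... | _ | inj₁ zv = inj₂ zv
... | inj₂ (fg p _) | inj₂ (fg q _) = clash a q p
... | inj₂ (fg p _) | inj₂ (fh q _) = clash a q p
... | inj₂ (fg _ p) | inj₂ (gh q _) = clash b q p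
... | inj₂ (fh p _) | inj₂ (fg q _) = clash a q p
... | inj₂ (fh p _) | inj₂ (fh q _) = clash a q p
... | inj₂ (fh _ p) | inj₂ (gh _ q) = clash c q p
... | inj₂ (gh p _) | inj₂ (fg _ q) = clash b q p
... | inj₂ (gh _ p) | inj₂ (fh _ q) = clash c q p
... | inj₂ (gh p _) | inj₂ (gh q _) = clash b q p

-- Pairwise disjoint triples.

Cyclic : (f g h : Labelling n) → Fin n → Fin n → Fin n → Pred (Fin n) 0ℓ
Cyclic f g h x y z v = Cell f g h x y z v ⊎ Cell f g h y z x v ⊎ Cell f g h z x y v

cyclic? : (f g h : Labelling n) (x y z : Fin n) → Decidable (Cyclic f g h x y z)
cyclic? f g h x y z v = cell? f g h x y z v ⊎-dec cell? f g h y z x v ⊎-dec cell? f g h z x y v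

-- The three cells differ pairwise in every label, so from a vertex `o` in one of them the other two
-- are disjoint. The three cells thus cost weight 2 instead of 3.
cyclic-near : Disjoint f g h x y → Disjoint f g h x z → Disjoint f g h y z →
  ∃ λ o → ∀ {v} → Cyclic f g h x y z v → Cell f g h o o o v ⊎ Disjoint f g h o v
cyclic-near {f = f} {g} {h} {x} {y} {z} xy@(a , b , c) xz@(a′ , b′ , c′) yz@(a″ , b″ , c″)
  with any? (cyclic? f g h x y z)
... | no ¬o = x , λ e → contradiction (_ , e) ¬o
... | yes (o , o∈) = o , near o∈
  where
  same : ∀ {x y z v} → Cell f g h x y z o → Cell f g h x y z v → Cell f g h o o o v ⊎ Disjoint f g h o v
  same (p , q , r) (p′ , q′ , r′) = inj₁ (trans p′ (≡-sym p) , trans q′ (≡-sym q) , trans r′ (≡-sym r))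
  apart : ∀ {x y z x′ y′ z′ v} → Cell f g h x y z o → Cell f g h x′ y′ z′ v →
    f x′ ≢ f x → g y′ ≢ g y → h z′ ≢ h z → Cell f g h o o o v ⊎ Disjoint f g h o v
  apart (p , q , r) (p′ , q′ , r′) a b c = inj₂ (via p′ p a , via q′ q b , via r′ r c)
  near : ∀ {v} → Cyclic f g h x y z o → Cyclic f g h x y z v → Cell f g h o o o v ⊎ Disjoint f g h o v
  near (byf d) (byf e) = same d e
  near (byg d) (byg e) = same d e
  near (byh d) (byh e) = same d e
  near (byf d) (byg e) = apart d e a b″ (≢-sym c′)
  near (byf d) (byh e) = apart d e a′ (≢-sym b) (≢-sym c″)
  near (byg d) (byf e) = apart d e (≢-sym a) (≢-sym b″) c′
  near (byg d) (byh e) = apart d e a″ (≢-sym b′) c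
  near (byh d) (byf e) = apart d e (≢-sym a′) b c″
  near (byh d) (byg e) = apart d e (≢-sym a″) b′ (≢-sym c)

-- A vertex outside the six cells formed from the labels of x, y, z is missed by two of these vertices,
-- and three cyclically related cells lie in the union of one cell and one set of vertices disjoint from it.
no-disjoint-triple : Balanced f g h → Disjoint f g h x y → Disjoint f g h x z → Disjoint f g h y z → ⊥
no-disjoint-triple {f = f} {g} {h} {x} {y} {z} B xy@(a , b , c) xz@(a′ , b′ , c′) yz@(a″ , b″ , c″)
  with cyclic-near {f = f} {g} {h} xy xz yz | cyclic-near {f = f} {g} {h} xz xy (Disjoint-sym {f = f} {g} {h} yz)
... | o , near | o′ , near′ =
  cover 2 1 (disjoint? f g h x) (disjoint-light B x)
    (disjointPiece B y ∷ disjointPiece B z ∷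
     light 1 (cell? f g h o o o) (cell-light B o) ∷ disjointPiece B o ∷
     light 1 (cell? f g h o o o) (cell-light B o) ∷ disjointPiece B o ∷
     light 1 (cell? f g h o′ o′ o′) (cell-light B o′) ∷ disjointPiece B o′ ∷
     light 1 (cell? f g h o′ o′ o′) (cell-light B o′) ∷ disjointPiece B o′ ∷ []) covered
  where
  covered : ∀ v → Covered v 2 _
  even : ∀ {v} → Cyclic f g h x y z v → Covered v 2 _
  odd  : ∀ {v} → Cyclic f g h x z y v → Covered v 2 _

  covered v with disjoint⊎meets f g h x v | disjoint⊎meets f g h y v | disjoint⊎meets f g h z v
  covered v | inj₁ d | _ | _ with missed-twice B xy xz yz d
  ... | inj₁ e = hit d (hit e done)
  ... | inj₂ e = hit d (skip (hit e done))
  covered v | _ | inj₁ d | _ with missed-twice B (Disjoint-sym {f = f} {g} {h} xy) yz xz d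
  ... | inj₁ e = hit e (hit d done)
  ... | inj₂ e = skip (hit d (hit e done))
  covered v | _ | _ | inj₁ d
    with missed-twice B (Disjoint-sym {f = f} {g} {h} xz) (Disjoint-sym {f = f} {g} {h} yz) xy d
  ... | inj₁ e = hit e (skip (hit d done))
  ... | inj₂ e = skip (hit e (hit d done))
  covered v | inj₂ (byf p) | inj₂ (byf q) | _ = clash a q p
  covered v | inj₂ (byg p) | inj₂ (byg q) | _ = clash b q p
  covered v | inj₂ (byh p) | inj₂ (byh q) | _ = clash c q p
  covered v | inj₂ (byf p) | _ | inj₂ (byf q) = clash a′ q p
  covered v | inj₂ (byg p) | _ | inj₂ (byg q) = clash b′ q p
  covered v | inj₂ (byh p) | _ | inj₂ (byh q) = clash c′ q p
  covered v | _ | inj₂ (byf p) | inj₂ (byf q) = clash a″ q p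
  covered v | _ | inj₂ (byg p) | inj₂ (byg q) = clash b″ q p
  covered v | _ | inj₂ (byh p) | inj₂ (byh q) = clash c″ q p
  covered v | inj₂ (byf p) | inj₂ (byg q) | inj₂ (byh r) = even (byf (p , q , r))
  covered v | inj₂ (byh p) | inj₂ (byf q) | inj₂ (byg r) = even (byg (q , r , p))
  covered v | inj₂ (byg p) | inj₂ (byh q) | inj₂ (byf r) = even (byh (r , p , q))
  covered v | inj₂ (byf p) | inj₂ (byh q) | inj₂ (byg r) = odd (byf (p , r , q))
  covered v | inj₂ (byh p) | inj₂ (byg q) | inj₂ (byf r) = odd (byg (r , q , p))
  covered v | inj₂ (byg p) | inj₂ (byf q) | inj₂ (byh r) = odd (byh (q , p , r))

  even e with near e
  ... | inj₁ k = skip (skip (skip (hit k (skip (hit k done)))))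
  ... | inj₂ k = skip (skip (skip (skip (hit k (skip (hit k done))))))
  odd e with near′ e
  ... | inj₁ k = skip (skip (skip (skip (skip (skip (skip (hit k (skip (hit k done)))))))))
  ... | inj₂ k = skip (skip (skip (skip (skip (skip (skip (skip (hit k (skip (hit k done))))))))))

-- All vertices disjoint from a given one lie in a single cell.

agreeTwice : Balanced f g h → Disjoint f g h x y → Disjoint f g h x z → AgreeTwice f g h y z
agreeTwice B xy xz with disjoint⊎agreeTwice B xy xz
... | inj₁ yz = ⊥-elim (no-disjoint-triple B xy xz yz)
... | inj₂ e  = e

module _ (B : Balanced f g h) {x x′ y : Fin n}
  (yx : Disjoint f g h y x) (yx′ : Disjoint f g h y x′)
  (fxx′ : f x ≢ f x′) (gx′ : g x′ ≡ g x) (hx′ : h x′ ≡ h x) where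

  private
    -- Such a `v` shares two labels with `x` and two with `x′`. It cannot share `f` with both, so
    -- with one of them it shares `g` and `h`.
    disjoint-near : ∀ {v} → Disjoint f g h y v → g v ≡ g x × h v ≡ h x
    disjoint-near yv with agreeTwice B yx yv | agreeTwice B yx′ yv
    ... | gh p q | _      = p , q
    ... | _      | gh p q = trans p gx′ , trans q hx′
    ... | fg p _ | fg q _ = clash fxx′ p q
    ... | fg p _ | fh q _ = clash fxx′ p q
    ... | fh p _ | fg q _ = clash fxx′ p q
    ... | fh p _ | fh q _ = clash fxx′ p q

    -- Here `v` differs in `f` from `x` or from `x′`, hence is disjoint from it, as `y` is.
    far-agreeTwice : ∀ {v} → g v ≢ g x → h v ≢ h x → AgreeTwice f g h y v
    far-agreeTwice {v} b c with f v ≟ f x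
    ... | no ¬a = agreeTwice B (Disjoint-sym {f = f} {g} {h} yx) (¬a , b , c)
    ... | yes a = agreeTwice B (Disjoint-sym {f = f} {g} {h} yx′)
      ((λ e → fxx′ (trans (≡-sym a) e)) , via refl gx′ b , via refl hx′ c)

    choose : ∀ u → ∃ λ p → f p ≢ f u × f p ≢ f y × g p ≡ g x × h p ≡ h x
    choose u with f x ≟ f u
    ... | no ¬e = x , ¬e , proj₁ yx , refl , refl
    ... | yes e = x′ , (λ e′ → fxx′ (trans e (≡-sym e′))) , proj₁ yx′ , gx′ , hx′

    gxy : g x ≢ g y
    gxy = proj₁ (proj₂ yx)
    hxy : h x ≢ h y
    hxy = proj₂ (proj₂ yx)

  -- Take `v` outside the `g`-classes of `x` and `y`. Either it is as wanted, or it shares `f` and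
  -- `h` with `y`. In the latter case a vertex `u` outside the `f`-class of `y` and the `g`-class of
  -- `x` leads to a forbidden single agreement.
  mixed-vertex : ∃ λ v → f v ≡ f y × g v ≢ g x × g v ≢ g y × h v ≡ h x
  mixed-vertex with two-classes-omit₁₁ (swap₁₂ B) x y
  ... | v , gvx , gvy with h v ≟ h x
  mixed-vertex | v , gvx , gvy | yes hv with f v ≟ f y
  ... | yes fv = v , fv , gvx , gvy , hv
  ... | no ¬fv = contradiction (proj₁ (disjoint-near (¬fv , gvy , via hv refl hxy))) gvx
  mixed-vertex | v , gvx , gvy | no hvx with far-agreeTwice gvx hvx
  ... | fg _ q = contradiction q gvy
  ... | gh q _ = contradiction q gvy
  ... | fh fv hv with two-classes-omit₁₂ B y x
  ... | u , fuy , gux with choose u | h u ≟ h x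
  ... | p , fpu , fpy , gp , hp | yes hu with g u ≟ g y
  ...   | no ¬gu = contradiction (proj₁ (disjoint-near (fuy , ¬gu , via hu refl hxy))) gux
  -- `p` and `u` share `h` only, and `v` is disjoint from both.
  ...   | yes gu = ⊥-elim (no-single-agreement {x = v} {p} {u} (swap₁₃ B)
    (via hp hv hxy , via gp refl (≢-sym gvx) , via refl fv fpy)
    (via hu hv hxy , via gu refl (≢-sym gvy) , via refl fv fuy)
    (trans hu (≡-sym hp)) (via refl gp gux) (≢-sym fpu))
  mixed-vertex | v , gvx , gvy | no hvx | fh fv hv | u , fuy , gux | p , fpu , fpy , gp , hp | no hux
    with far-agreeTwice gux hux
  ... | fg e _ = contradiction e fuy
  ... | fh e _ = contradiction e fuy
  -- `u` and `v` share `h` only, and `p` is disjoint from both.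
  ... | gh gu hu = ⊥-elim (no-single-agreement {x = p} {u} {v} (swap₁₃ B)
    (via hu hp (≢-sym hxy) , via refl gp gux , ≢-sym fpu)
    (via hv hp (≢-sym hxy) , via refl gp gvx , via fv refl (≢-sym fpy))
    (trans hv (≡-sym hu)) (via refl gu gvy) (via fv refl (≢-sym fuy)))

-- `mixed-vertex`, applied also with `g` and `h` exchanged, gives `v` and `u` in the `f`-class of
-- `y`. There `y`, `v`, `u` form a transversal: in `g` their labels are that of `y`, a new one, that
-- of `x`; in `h` they are that of `y`, that of `x`, a new one.
no-twins : Balanced f g h → Disjoint f g h y x → Disjoint f g h y z →
  f x ≢ f z → g z ≡ g x → h z ≡ h x → ⊥
no-twins B yx@(a , b , c) yz@(a′ , b′ , c′) fxz gzx hzx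
  with mixed-vertex B yx yz fxz gzx hzx | mixed-vertex (swap₂₃ B) (a , c , b) (a′ , c′ , b′) fxz hzx gzx
... | v , fv , gvx , gvy , hv | u , fu , hux , huy , gu =
  no-transversal-in-class B fv fu
    (≢-sym gvy , via refl gu (≢-sym b) , via refl gu gvx)
    (via refl hv (≢-sym c) , ≢-sym huy , via hv refl (≢-sym hux))

disjoint-unique : Balanced f g h → Disjoint f g h y x → Disjoint f g h y z → Cell f g h x x x z
disjoint-unique {f = f} {g} {h} {x = x} {z = z} B yx@(a , b , c) yz@(a′ , b′ , c′)
  with f z ≟ f x | g z ≟ g x | h z ≟ h x | agreeTwice B yx yz
... | yes p | yes q | yes r | _ = p , q , r
... | no ¬p | _ | _ | gh q r = ⊥-elim (no-twins B yx yz (≢-sym ¬p) q r)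
... | _ | no ¬q | _ | fh p r = ⊥-elim (no-twins (swap₁₂ B) (b , a , c) (b′ , a′ , c′) (≢-sym ¬q) p r)
... | _ | _ | no ¬r | fg p q = ⊥-elim (no-twins (swap₁₃ B) (c , b , a) (c′ , b′ , a′) (≢-sym ¬r) q p)
... | no ¬p | _ | _ | fg p _ = contradiction p ¬p
... | no ¬p | _ | _ | fh p _ = contradiction p ¬p
... | _ | no ¬q | _ | fg _ q = contradiction q ¬q
... | _ | no ¬q | _ | gh q _ = contradiction q ¬q
... | _ | _ | no ¬r | fh _ r = contradiction r ¬r
... | _ | _ | no ¬r | gh _ r = contradiction r ¬r

-- Excluding disjoint pairs, then intersecting families.

third-label : Balanced f g h → Disjoint f g h x y → ∃ λ w → f w ≢ f x × f w ≢ f y ×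
  ((g w ≡ g x × h w ≡ h y) ⊎ (g w ≡ g y × h w ≡ h x))
third-label {f = f} {g} {h} {x} {y} B xy@(a , b , c) with two-classes-omit₁₁ B x y
... | w , fwx , fwy with disjoint⊎meets f g h x w | disjoint⊎meets f g h y w
-- If `w` were disjoint from `x`, it would lie in the cell of `y` and share `f` with it.
... | inj₁ xw | _ = contradiction (proj₁ (disjoint-unique B xy xw)) fwy
... | _ | inj₁ yw = contradiction (proj₁ (disjoint-unique B (Disjoint-sym {f = f} {g} {h} xy) yw)) fwx
... | inj₂ (byf p) | _ = contradiction p fwx
... | _ | inj₂ (byf q) = contradiction q fwy
... | inj₂ (byg p) | inj₂ (byg q) = clash b q p
... | inj₂ (byh p) | inj₂ (byh q) = clash c q p
... | inj₂ (byg p) | inj₂ (byh q) = w , fwx , fwy , inj₁ (p , q)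
... | inj₂ (byh p) | inj₂ (byg q) = w , fwx , fwy , inj₂ (q , p)

-- Writing labels as 1 (that of x), 2 (that of y) or 3 (another), x = 111, y = 222 and w = 312.
no-third-label : Balanced f g h → Disjoint f g h x y →
  ∀ {w} → f w ≢ f x → f w ≢ f y → g w ≡ g x → h w ≡ h y → ⊥
no-third-label {x = x} B xy@(a , b , c) {w} fwx fwy gw hw
  with third-label {x = x} (swap₁₂ B) (b , a , c) | third-label {x = x} (swap₁₃ B) (c , b , a)
... | u , gux , guy , inj₁ (fu , hu) | _ =
  no-transversal-in-class (swap₁₃ B) hw hu
    (via refl gw b , ≢-sym guy , via gw refl (≢-sym gux))
    (≢-sym fwy , via refl fu a , via refl fu fwx)
... | _ | v , hvx , hvy , inj₁ (gv , fv) =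
  no-transversal-in-class (swap₁₂ B) gw gv
    (≢-sym fwx , via refl fv (≢-sym a) , via refl fv fwy)
    (via refl hw (≢-sym c) , ≢-sym hvx , via hw refl (≢-sym hvy))
... | u , gux , guy , inj₂ (fu , hu) | v , hvx , hvy , inj₂ (gv , fv) =
  no-disjoint-triple {x = w} {u} {v} B
    (via fu refl (≢-sym fwy) , via refl gw gux , via hu hw (≢-sym c))
    (via fv refl (≢-sym fwx) , via gv gw b , via refl hw hvy)
    (via fv fu (≢-sym a) , via gv refl (≢-sym guy) , via refl hu hvx)

no-disjoint-pair : Balanced f g h → ¬ Disjoint f g h x y
no-disjoint-pair {f = f} {g} {h} B xy with third-label B xy
... | w , fwx , fwy , inj₁ (gw , hw) = no-third-label B xy fwx fwy gw hw
... | w , fwx , fwy , inj₂ (gw , hw) = no-third-label B (Disjoint-sym {f = f} {g} {h} xy) fwy fwx gw hw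

-- With `o` labelled 111, omitting two of its classes at a time and using that all pairs meet gives
-- `u` = 221, `v` = 212, `w` = 122. A vertex `t` with a third `f`-label would have to meet 11, 21,
-- 12 and 22 in its last two labels, which is impossible.
no-intersecting : {f g h : Labelling n} → Balanced f g h → (∀ x y → Meets f g h x y) → ¬ Fin n
no-intersecting {f = f} {g} {h} B meets o
  with two-classes-omit₁₂ B o o | two-classes-omit₁₂ (swap₂₃ B) o o | two-classes-omit₁₂ (swap₂₃ (swap₁₂ B)) o o
... | u , fu , gu | v , fv , hv | w , gw , hw with meets o u | meets o v | meets o w
... | byf p | _ | _ = contradiction p fu
... | byg p | _ | _ = contradiction p gu
... | _ | byf p | _ = contradiction p fv
... | _ | byh p | _ = contradiction p hv
... | _ | _ | byg p = contradiction p gw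
... | _ | _ | byh p = contradiction p hw
... | byh hu | byg gv | byf fw with meets u v | meets u w | meets v w
... | byg p | _ | _ = contradiction (trans (≡-sym p) gv) gu
... | byh p | _ | _ = contradiction (trans p hu) hv
... | _ | byf p | _ = contradiction (trans (≡-sym p) fw) fu
... | _ | byh p | _ = contradiction (trans p hu) hw
... | _ | _ | byf p = contradiction (trans (≡-sym p) fw) fv
... | _ | _ | byg p = contradiction (trans p gv) gw
... | byf fvu | byg gwu | byh hwv with two-classes-omit₁₁ B o u
... | t , fto , ftu with meets o t | meets u t | meets v t | meets w t
... | byf p | _ | _ | _ = contradiction p fto
... | _ | byf p | _ | _ = contradiction p ftu
... | _ | _ | byf p | _ = contradiction (trans p fvu) ftu
... | _ | _ | _ | byf p = contradiction (trans p fw) fto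
... | byg p | byg q | _ | _ = clash gu q p
... | byh p | _ | byh q | _ = clash hv q p
... | byg p | _ | _ | byg q = clash gw q p
... | byh p | _ | _ | byh q = clash hw q p
... | byg p | byh q | _ | byh r = clash hw r (trans q hu)
... | byh p | _ | byg q | byg r = clash gw r (trans q gv)

no-balanced : {f g h : Labelling n} → Balanced f g h → ¬ Fin n
no-balanced {f = f} {g} {h} B = no-intersecting B meets
  where
  meets : ∀ x y → Meets f g h x y
  meets x y with disjoint⊎meets f g h x y
  ... | inj₁ d = ⊥-elim (no-disjoint-pair B d)
  ... | inj₂ e = e

-- Labelling the components of a relation.

module _ {R : Rel (Fin n) 0ℓ} (R? : B.Decidable R) {_∼_ : Rel (Fin n) 0ℓ}
  (equiv : IsEquivalence _∼_) (R⇒∼ : ∀ {u v} → R u v → u ∼ v) where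
  private module E = IsEquivalence equiv

  -- As in union-find, the pairs are processed one by one from the identity labelling, and each
  -- related pair merges two labels. Soundness with respect to an equivalence containing `R` is kept
  -- as an invariant.
  label-components-along : (es : List (Fin n × Fin n)) → ∃ λ (f : Labelling n) →
    All (λ (u , v) → R u v → f u ≡ f v) es × (∀ {u v} → f u ≡ f v → u ∼ v)
  label-components-along [] = id , [] , λ { refl → E.refl }
  label-components-along ((a , b) ∷ es) with label-components-along es | R? a b
  ... | f , constant , sound | no ¬r = f , (λ r → contradiction r ¬r) ∷ constant , sound
  ... | f , constant , sound | yes r =
    merge ∘ f , (λ _ → merge-ab) ∷ All.map (cong merge ∘_) constant , sound′
    where
    merge : Labelling n
    merge c = if does (c ≟ f a) then f b else c

    merge-ab : merge (f a) ≡ merge (f b)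
    merge-ab with f a ≟ f a | f b ≟ f a
    ... | yes _ | yes _ = refl
    ... | yes _ | no  _ = refl
    ... | no ¬e | _     = contradiction refl ¬e

    -- Every merged label is the old label of a vertex equivalent to `u`, so soundness reduces to
    -- that of `f`.
    represent : ∀ u → ∃ λ u′ → u ∼ u′ × f u′ ≡ merge (f u)
    represent u with f u ≟ f a
    ... | yes e = b , E.trans (sound e) (R⇒∼ r) , refl
    ... | no  _ = u , E.refl , refl

    sound′ : ∀ {u v} → merge (f u) ≡ merge (f v) → u ∼ v
    sound′ {u} {v} e with represent u | represent v
    ... | u′ , u∼u′ , fu′ | v′ , v∼v′ , fv′ =
      E.trans u∼u′ (E.trans (sound (trans fu′ (trans e (≡-sym fv′)))) (E.sym v∼v′))

  label-components : ∃ λ (f : Labelling n) →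
    (∀ {u v} → R u v → f u ≡ f v) × (∀ {u v} → f u ≡ f v → u ∼ v)
  label-components with label-components-along (cartesianProduct (allFin n) (allFin n))
  ... | f , constant , sound =
    f , (λ {u} {v} → All.lookup constant (∈-cartesianProduct⁺ (∈-allFin u) (∈-allFin v))) , sound

-- From coloured graphs to balanced labellings.

adj? : (G : Graph n) (v : Fin n) → Decidable (Adj G v)
adj? G v u = adj G v u Bool.≟ true

module _ {G : Graph n} (χ : EdgeColouring G 3) (c : Fin 3) where

  colEdge? : B.Decidable (ColEdge χ c)
  colEdge? u v with adj? G u v
  ... | no ¬e = no λ (e , _) → ¬e e
  ... | yes e with colour χ u v e ≟ c
  ...   | yes p = yes (e , p)
  -- The colour depends on the adjacency proof, but any two such proofs coincide because equality of
  -- booleans is decidable.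
  ...   | no ¬p = no λ (e′ , p) → ¬p (trans (cong (colour χ u v) (Decidable⇒UIP.≡-irrelevant Bool._≟_ e e′)) p)

  colEdge-sym : ∀ {u v} → ColEdge χ c u v → ColEdge χ c v u
  colEdge-sym {u} {v} (e , p) = e′ , trans (colourSym χ v u e′ e) p
    where e′ = trans (sym G v u) e

  walk-trans : ∀ {u v w} → Walk χ c u v → Walk χ c v w → Walk χ c u w
  walk-trans here       q = q
  walk-trans (step e p) q = step e (walk-trans p q)

  walk-sym : ∀ {u v} → Walk χ c u v → Walk χ c v u
  walk-sym here       = here
  walk-sym (step e p) = walk-trans (walk-sym p) (step (colEdge-sym e) here)

  component-labelling : ∃ λ (f : Labelling n) →
    (∀ {u v} → ColEdge χ c u v → f u ≡ f v) × (∀ {u v} → f u ≡ f v → Walk χ c u v)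
  component-labelling = label-components colEdge?
    (record { refl = here ; sym = walk-sym ; trans = walk-trans }) (λ e → step e here)

  walk-inColour : ∀ {u v} → u ≢ v → Walk χ c u v → InColour χ c u
  walk-inColour u≢v here       = contradiction refl u≢v
  walk-inColour u≢v (step e _) = _ , e

-- A label class may be a single vertex without an edge of the colour. A second member yields a
-- nontrivial walk, hence an incident edge.
another-member : {xs : List (Fin n)} → Unique xs → 2 ≤ length xs → ∀ u → ∃ λ v → v ∈ xs × u ≢ v
another-member {xs = x ∷ y ∷ _} ((x≢y ∷ _) ∷ _) _ u with u ≟ x
... | yes refl = y , Any.there (Any.here refl) , x≢y
... | no  u≢x  = x , Any.here refl , u≢x
another-member {xs = []}    _ ()
another-member {xs = _ ∷ []} _ (s≤s ())

-- The inequality is strict because `v` itself is neither its own neighbour nor in `P`.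
degree+size<n : (G : Graph n) (v : Fin n) (P? : Decidable P) →
  (∀ {u} → Adj G v u → P u → ⊥) → ¬ P v → degree G v + size P? < n
degree+size<n {n} G v P? exclusive ¬Pv = begin-strict
  degree G v + size P?                    ≤⟨ length-filter-exclusive (adj? G v) P? exclusive (allFin n) ⟩
  size (λ u → adj? G v u ⊎-dec P? u)      <⟨ filter-notAll (λ u → adj? G v u ⊎-dec P? u) (allFin n)
                                               (lose (∈-allFin v) [ loopless , ¬Pv ]′) ⟩
  length (allFin n)                       ≡⟨ length-allFin n ⟩
  n                                       ∎
  where
  open ≤-Reasoning
  loopless : ¬ Adj G v v
  loopless e with trans (≡-sym (irrfl G v)) e
  ... | ()

exclusive-light : (G : Graph n) (v : Fin n) → 5 * n ≤ 6 * degree G v → (P? : Decidable P) →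
  (∀ {u} → Adj G v u → P u → ⊥) → ¬ P v → Light 1 P?
exclusive-light {n} G v deg P? exclusive ¬Pv = +-cancelˡ-< (5 * n) _ _ (begin-strict
  5 * n + 6 * size P?               ≤⟨ +-monoˡ-≤ (6 * size P?) deg ⟩
  6 * degree G v + 6 * size P?      ≡⟨ *-distribˡ-+ 6 (degree G v) (size P?) ⟨
  6 * (degree G v + size P?)        <⟨ *-monoʳ-< 6 (degree+size<n G v P? exclusive ¬Pv) ⟩
  6 * n                             ≡⟨ *-distribʳ-+ n 5 1 ⟩
  5 * n + 1 * n                     ∎)
  where open ≤-Reasoning

degree-< : (G : Graph n) (v : Fin n) → degree G v < n
degree-< {n} G v = ≤-<-trans (m≤m+n _ _)
  (degree+size<n G v (λ _ → no id) (λ _ ()) id)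

-- Orders 1 and 2 would require 5 ≤ 0 and 10 ≤ 6. With order at least 3, a class of at least half
-- the vertices has two members.
order>2 : ∀ n d → d < n → 5 * n ≤ 6 * d → 2 < n
order>2 1 0 _ ()
order>2 1 (suc d) (s≤s ()) _
order>2 2 0 _ ()
order>2 2 1 _ (s≤s (s≤s (s≤s (s≤s (s≤s (s≤s ()))))))
order>2 2 (suc (suc d)) (s≤s (s≤s ())) _
order>2 (suc (suc (suc n))) d _ _ = s≤s (s≤s (s≤s z≤n))

half≥2 : ∀ {n} k → 2 < n → n ≤ 2 * k → 2 ≤ k
half≥2 0 2<n n≤ = contradiction (<-≤-trans 2<n n≤) λ ()
half≥2 1 2<n n≤ = contradiction (<-≤-trans 2<n n≤) (<-irrefl refl)
half≥2 (suc (suc k)) _ _ = s≤s (s≤s z≤n)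

theorem1p7 : (n : ℕ) (G : Graph n) →
    (∀ v → 5 * n ≤ 6 * degree G v) →
    (χ : EdgeColouring G 3) →
    ∃ λ c → ∃ λ S → InOneComponent χ c S × n ≤ 2 * length S
-- Without vertices the empty set is large enough.
theorem1p7 zero G deg χ = 0F , [] , ([] , (λ ()) , λ ()) , z≤n
theorem1p7 n@(suc _) G deg χ
  with any? (λ c → any? (λ v → n ≤? 2 * size (class? (proj₁ (component-labelling χ c)) v)))
... | yes (c , v , large) = c , S , (S-unique , inColour , connected) , large
  where
  labels = component-labelling χ c
  label = proj₁ labels
  S = filter (class? label v) (allFin n)
  S-unique = filter⁺ (class? label v) (allFin⁺ n)

  connected : ∀ {u w} → u ∈ S → w ∈ S → Walk χ c u w
  connected u∈S w∈S = proj₂ (proj₂ labels)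
    (trans (proj₂ (∈-filter⁻ (class? label v) {xs = allFin n} u∈S))
           (≡-sym (proj₂ (∈-filter⁻ (class? label v) {xs = allFin n} w∈S))))

  inColour : ∀ {u} → u ∈ S → InColour χ c u
  inColour {u} u∈S
    with another-member S-unique (half≥2 (length S) (order>2 n _ (degree-< G v) (deg v)) large) u
  ... | w , w∈S , u≢w = walk-inColour χ c u≢w (connected u∈S w∈S)
... | no ¬large = ⊥-elim (no-balanced balancedLabels Fin.zero)
  where
  label : Fin 3 → Labelling n
  label c = proj₁ (component-labelling χ c)

  class-light : ∀ c v → Light 3 (class? (label c) v)
  -- Failure of the search gives twice the class size below `n`; this is tripled.
  class-light c v = subst (_< 3 * n) (≡-sym (*-assoc 3 2 (size (class? (label c) v))))
    (*-monoʳ-< 3 (≰⇒> λ large → ¬large (c , v , large)))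

  adjacent-meet : ∀ {v u} → Adj G v u → ¬ Disjoint (label 0F) (label 1F) (label 2F) v u
  adjacent-meet {v} {u} e (a , b , d) with colour χ v u e in eq
  ... | 0F = a (≡-sym (proj₁ (proj₂ (component-labelling χ 0F)) (e , eq)))
  ... | 1F = b (≡-sym (proj₁ (proj₂ (component-labelling χ 1F)) (e , eq)))
  ... | 2F = d (≡-sym (proj₁ (proj₂ (component-labelling χ 2F)) (e , eq)))

  balancedLabels : Balanced (label 0F) (label 1F) (label 2F)
  balancedLabels = record
    { disjoint-light = λ v → exclusive-light G v (deg v) (disjoint? (label 0F) (label 1F) (label 2F) v)
        adjacent-meet (λ (a , _) → a refl)
    ; class₁-light = class-light 0F
    ; class₂-light = class-light 1F
    ; class₃-light = class-light 2F
    }
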